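{- Let $(D,\alpha)$ be the division algebra of degree three with involution of the second kind, with constants $a,b$, described in the context. There is no element of $\mathbb{G}(F)$ apart from the identity which is an eigenvector for the involution $\alpha$, i.e. $\alpha(g)\neq\pm g$ for all $g\in\mathbb{G}(F)$, $g\neq 1$. The eigenvectors of $\mathbb{U}(F)$ under $\alpha$ are the fourth roots of unity in $E^\times$: an element $g\in\mathbb{U}(F)$ satisfies $\alpha(g)=g$ or $\alpha(g)=-g$ if and only if $g$ is a fourth root of unity in $E^\times$.
   Context: Let $E/F$ be a quadratic extension of number fields, $\tau$ (also written $x\mapsto\bar x$) the non-trivial element of $\mathrm{Gal}(E/F)$, $L\supset E$ a field such that $L/F$ is Galois with cyclic group of order $6$, $\rho$ a generator of $\mathrm{Gal}(L/E)$; $\tau$ is extended to $L$ as the element of order two of $\mathrm{Gal}(L/F)$, and $M=L^\tau$. Let $a\in\mathfrak{o}_E\setminus\mathfrak{o}_F$ with $a\notin \mathrm{N}_{L/E}(L^\times)$ and $b\in M^\times$ with $\mathrm{N}_{E/F}(a)=\mathrm{N}_{M/F}(b)$. Then $D=L\oplus Lz\oplus Lz^2$ with $z^3=a$ and $zl=\rho(l)z$ for $l\in L$ is a central division algebra of degree three over $E$, and $\alpha$ is the involution of the second kind (anti-automorphism of order two restricting to $\tau$ on $E$) determined by $\alpha|_L=\tau$ and $\alpha(z)=\frac{b}{a}z^2$. Put $\mathbb{U}(F)=\{g\in D^\times\mid\alpha(g)g=1\}$ and $\mathbb{G}(F)=\{g\in\mathbb{U}(F)\mid \mathrm{N}_{rd}(g)=1\}$,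 where $\mathrm{N}_{rd}$ is the reduced norm. -}

module Defs where

open import Level using (Level; _⊔_; 0ℓ) renaming (suc to lsuc)
open import Algebra.Apartness.Bundles using (HeytingField; HeytingCommutativeRing)
open import Algebra.Bundles using (CommutativeRing; Group)
open import Algebra.Bundles.Raw using (RawRing)
open import Algebra.Definitions using (Invertible)
open import Algebra.Morphism.Bundles using (RingHomomorphism)
open import Algebra.Morphism.Structures using (IsRingIsomorphism)
import Algebra.Definitions.RawMonoid as MonoidDefs
import Algebra.Definitions.RawSemiring as SemiringDefs
import Algebra.Morphism.Construct.Composition as Composition
import Algebra.Morphism.Construct.Identity as Identity
open import Data.Fin using (Fin; zero; suc; toℕ; punchIn)
open import Data.Integer using (ℤ; 0ℤ)
open import Data.Nat using (ℕ; zero; suc)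
open import Data.Nat.GeneralisedArithmetic using (fold)
open import Data.Product using (∃; ∃-syntax; ∃!; _×_; _,_; proj₁; proj₂)
open import Data.Rational using () renaming (_/_ to _/ℚ_; +-*-rawRing to ℚ-rawRing)
open import Data.Vec.Functional using (Vector; []; _∷_)
open import Function using (id; _∘_)
open import Function.Definitions using (Bijective)
open import Relation.Binary.PropositionalEquality using (_≡_)
open import Relation.Nullary using (¬_)
import Relation.Binary.Reasoning.Setoid as SetoidReasoning

-- Number fields are discrete, so the apartness is the denial inequality.
record Field c ℓ : Set (lsuc (c ⊔ ℓ)) where
  field
    heytingField : HeytingField c ℓ ℓ

  open HeytingField heytingField using (_#_; heytingCommutativeRing; #⇒invertible)

  commutativeRing : CommutativeRing c ℓ
  commutativeRing = HeytingCommutativeRing.commutativeRing heytingCommutativeRing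

  open CommutativeRing commutativeRing public
  open SemiringDefs (RawRing.rawSemiring rawRing) public using (_^_; sum)

  field
    ≉⇒# : ∀ {x y} → x ≉ y → x # y

  -- The library inverts the difference x - 0#.
  inverse : ∀ x → x ≉ 0# → Carrier
  inverse x x≉0 = proj₁ (#⇒invertible (≉⇒# x≉0))

_∘ʰ_ : ∀ {c ℓ} {A B C : Field c ℓ} →
       RingHomomorphism (Field.rawRing B) (Field.rawRing C) →
       RingHomomorphism (Field.rawRing A) (Field.rawRing B) →
       RingHomomorphism (Field.rawRing A) (Field.rawRing C)
_∘ʰ_ {C = C} g f = record
  { isRingHomomorphism = Composition.isRingHomomorphism (Field.trans C)
      (RingHomomorphism.isRingHomomorphism f) (RingHomomorphism.isRingHomomorphism g) }

module _ {a b ℓ₁ ℓ₂} {A : RawRing a ℓ₁} {B : RawRing b ℓ₂} (ι : RingHomomorphism A B) where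
  private
    module A = RawRing A
    module B = RawRing B
  open RingHomomorphism ι using (⟦_⟧)
  open SemiringDefs B.rawSemiring using (sum)

  IsBasis : ∀ {n} → Vector B.Carrier n → Set _
  IsBasis {n} v = ∀ x → ∃! (λ c d → ∀ i → c i A.≈ d i)
    (λ (c : Vector A.Carrier n) → sum (λ i → ⟦ c i ⟧ B.* v i) B.≈ x)

  HasDegree : ℕ → Set _
  HasDegree n = ∃ λ (v : Vector B.Carrier n) → IsBasis v

record NumberField c ℓ : Set (lsuc (c ⊔ ℓ)) where
  field
    asField : Field c ℓ

  open Field asField public

  field
    ιℚ     : RingHomomorphism ℚ-rawRing rawRing
    finite : ∃[ n ] HasDegree ιℚ n

  fromℤ : ℤ → Carrier
  fromℤ k = RingHomomorphism.⟦_⟧ ιℚ (k /ℚ 1)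

  -- c lists the lower coefficients of a monic polynomial of degree n.
  IsIntegral : Carrier → Set ℓ
  IsIntegral x = ∃[ n ] ∃ λ (c : Vector ℤ n) →
    x ^ n + sum (λ i → fromℤ (c i) * x ^ toℕ i) ≈ 0#

  0-integral : IsIntegral 0#
  0-integral = 1 , (0ℤ ∷ []) , (begin
    0# * 1# + (fromℤ 0ℤ * 1# + 0#) ≈⟨ +-congʳ (zeroˡ 1#) ⟩
    0# + (fromℤ 0ℤ * 1# + 0#)      ≈⟨ +-identityˡ _ ⟩
    fromℤ 0ℤ * 1# + 0#             ≈⟨ +-identityʳ _ ⟩
    fromℤ 0ℤ * 1#                  ≈⟨ *-identityʳ _ ⟩
    fromℤ 0ℤ                       ≈⟨ RingHomomorphism.0#-homo ιℚ ⟩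
    0#                             ∎)
    where open SetoidReasoning setoid

module _ {c ℓ} {K L : Field c ℓ}
         (ι : RingHomomorphism (Field.rawRing K) (Field.rawRing L)) where
  private
    module K = Field K
    module L = Field L
  open RingHomomorphism ι using (⟦_⟧)

  record Automorphism : Set (c ⊔ ℓ) where
    field
      ap                : L.Carrier → L.Carrier
      isRingIsomorphism : IsRingIsomorphism L.rawRing L.rawRing ap
      fixes             : ∀ x → ap ⟦ x ⟧ L.≈ ⟦ x ⟧

    open IsRingIsomorphism isRingIsomorphism public

  open Automorphism using (ap)

  private
    inverseAut : Automorphism → Automorphism
    inverseAut σ = record
      { ap                = s⁻¹
      ; isRingIsomorphism = record
        { isRingMonomorphism = record
          { isRingHomomorphism = record
            { isSemiringHomomorphism = record
              { isNearSemiringHomomorphism = record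
                { +-isMonoidHomomorphism = record
                  { isMagmaHomomorphism = record
                    { isRelHomomorphism = record { cong = s⁻¹-cong }
                    ; homo = λ x y → S.injective (L.trans (right _)
                        (L.sym (L.trans (S.+-homo _ _) (L.+-cong (right x) (right y)))))
                    }
                  ; ε-homo = S.injective (L.trans (right _) (L.sym S.0#-homo))
                  }
                ; *-homo = λ x y → S.injective (L.trans (right _)
                    (L.sym (L.trans (S.*-homo _ _) (L.*-cong (right x) (right y)))))
                }
              ; 1#-homo = S.injective (L.trans (right _) (L.sym S.1#-homo))
              }
            ; -‿homo = λ x → S.injective (L.trans (right _)
                (L.sym (L.trans (S.-‿homo _) (L.-‿cong (right x)))))
            }
          ; injective = λ {x} {y} p →
              L.trans (L.sym (right x)) (L.trans (S.⟦⟧-cong p) (right y))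
          }
        ; surjective = λ y → ap σ y , λ p →
            L.trans (s⁻¹-cong p) (S.injective (right _))
        }
      ; fixes = λ x → S.injective (L.trans (right _) (L.sym (S.fixes x)))
      }
      where
      module S = Automorphism σ
      s⁻¹ : L.Carrier → L.Carrier
      s⁻¹ y = proj₁ (S.surjective y)
      right : ∀ y → ap σ (s⁻¹ y) L.≈ y
      right y = proj₂ (S.surjective y) L.refl
      s⁻¹-cong : ∀ {x y} → x L.≈ y → s⁻¹ x L.≈ s⁻¹ y
      s⁻¹-cong p = S.injective (L.trans (right _) (L.trans p (L.sym (right _))))

  Gal : Group (c ⊔ ℓ) (c ⊔ ℓ)
  Gal = record
    { Carrier = Automorphism
    ; _≈_     = λ σ σ′ → ∀ x → ap σ x L.≈ ap σ′ x
    ; _∙_     = λ σ σ′ → record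
      { ap                = ap σ ∘ ap σ′
      ; isRingIsomorphism = Composition.isRingIsomorphism L.trans
          (Automorphism.isRingIsomorphism σ′) (Automorphism.isRingIsomorphism σ)
      ; fixes             = λ x → L.trans
          (Automorphism.⟦⟧-cong σ (Automorphism.fixes σ′ x)) (Automorphism.fixes σ x)
      }
    ; ε       = record
      { ap                = id
      ; isRingIsomorphism = Identity.isRingIsomorphism L.rawRing L.refl
      ; fixes             = λ _ → L.refl
      }
    ; _⁻¹     = inverseAut
    ; isGroup = record
      { isMonoid = record
        { isSemigroup = record
          { isMagma = record
            { isEquivalence = record
              { refl  = λ _ → L.refl
              ; sym   = λ p x → L.sym (p x)
              ; trans = λ p q x → L.trans (p x) (q x)
              }
            ; ∙-cong = λ {σ} p q x → L.trans (Automorphism.⟦⟧-cong σ (q x)) (p _)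
            }
          ; assoc = λ _ _ _ _ → L.refl
          }
        ; identity = (λ _ _ → L.refl) , (λ _ _ → L.refl)
        }
      ; inverse = (λ σ x → Automorphism.injective σ (proj₂ (Automorphism.surjective σ _) L.refl))
                , (λ σ x → proj₂ (Automorphism.surjective σ x) L.refl)
      ; ⁻¹-cong = λ {σ} {σ′} p x → Automorphism.injective σ (L.trans
          (proj₂ (Automorphism.surjective σ x) L.refl)
          (L.sym (L.trans (p _) (proj₂ (Automorphism.surjective σ′ x) L.refl))))
      }
    }

  record IsFiniteGalois : Set (c ⊔ ℓ) where
    field
      finite     : ∃[ n ] HasDegree ι n
      fixedField : ∀ x → (∀ (σ : Automorphism) → ap σ x L.≈ x) → ∃[ y ] ⟦ y ⟧ L.≈ x

module _ {c ℓ} (G : Group c ℓ) where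
  open Group G
  open MonoidDefs rawMonoid using () renaming (_×_ to _times_)

  -- Natural exponents suffice because this is only used for finite groups.
  IsGenerator : Carrier → Set _
  IsGenerator g = ∀ h → ∃[ k ] k times g ≈ h

  IsCyclicOfOrder : ℕ → Set _
  IsCyclicOfOrder n = ∃[ g ] Bijective _≡_ _≈_ (λ (k : Fin n) → toℕ k times g)

module _ {c ℓ} (R : RawRing c ℓ) where
  open RawRing R
  open SemiringDefs rawSemiring using (_^_; sum; product)

  -- x · σ(x) ⋯ σⁿ⁻¹(x): the norm of x in an extension that is Galois with
  -- cyclic group of order n generated by (the restriction of) σ.
  cyclicNorm : ℕ → (Carrier → Carrier) → Carrier → Carrier
  cyclicNorm n σ x = product (λ (i : Fin n) → fold x σ (toℕ i))

  -- Laplace expansion along the first row.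
  det : ∀ {n} → (Fin n → Fin n → Carrier) → Carrier
  det {zero}  A = 1#
  det {suc n} A = sum λ j →
    (- 1#) ^ toℕ j * (A zero j * det (λ i k → A (suc i) (punchIn j k)))

record Setting c ℓ : Set (lsuc (c ⊔ ℓ)) where
  field
    F E : NumberField c ℓ
    L   : Field c ℓ

  module F = NumberField F
  module E = NumberField E
  module L = Field L

  field
    F⊂E : RingHomomorphism F.rawRing E.rawRing
    E⊂L : RingHomomorphism E.rawRing L.rawRing

  F⊂L : RingHomomorphism (Field.rawRing F.asField) (Field.rawRing L)
  F⊂L = _∘ʰ_ {A = F.asField} {B = E.asField} {C = L} E⊂L F⊂E

  module F⊂E = RingHomomorphism F⊂E
  module E⊂L = RingHomomorphism E⊂L

  GalE/F : Group (c ⊔ ℓ) (c ⊔ ℓ)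
  GalE/F = Gal {K = F.asField} {L = E.asField} F⊂E
  GalL/E : Group (c ⊔ ℓ) (c ⊔ ℓ)
  GalL/E = Gal {K = E.asField} {L = L} E⊂L
  GalL/F : Group (c ⊔ ℓ) (c ⊔ ℓ)
  GalL/F = Gal {K = F.asField} {L = L} F⊂L

  module GalE/F = Group GalE/F
  module GalL/E = Group GalL/E
  module GalL/F = Group GalL/F

  field
    quadratic : HasDegree F⊂E 2
    galois    : IsFiniteGalois {K = F.asField} {L = L} F⊂L
    cyclic    : IsCyclicOfOrder GalL/F 6

    -- conj is the map x ↦ x̄ on E, and τ is its extension to L.
    conj      : GalE/F.Carrier
    conj≉1    : ¬ conj GalE/F.≈ GalE/F.ε
    τ         : GalL/F.Carrier
    τ≉1       : ¬ τ GalL/F.≈ GalL/F.ε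
    τ²≈1      : (τ GalL/F.∙ τ) GalL/F.≈ GalL/F.ε

  conj· : E.Carrier → E.Carrier
  conj· = Automorphism.ap conj

  τ· : L.Carrier → L.Carrier
  τ· = Automorphism.ap τ

  field
    τ-extends : ∀ x → τ· (E⊂L.⟦ x ⟧) L.≈ E⊂L.⟦ conj· x ⟧
    ρ         : GalL/E.Carrier
    ρ-gen     : IsGenerator GalL/E ρ

  ρ· : L.Carrier → L.Carrier
  ρ· = Automorphism.ap ρ

  field
    a       : E.Carrier
    a∈𝔬E    : E.IsIntegral a
    a∉𝔬F    : ¬ (∃[ x ] F.IsIntegral x × F⊂E.⟦ x ⟧ E.≈ a)
    a∉N     : ¬ (∃[ x ] x L.≉ L.0# × cyclicNorm L.rawRing 3 ρ· x L.≈ E⊂L.⟦ a ⟧)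

    -- M is the subfield of L fixed by τ; ρ commutes with τ and restricts to
    -- a generator of Gal(M/F), which has order three.
    b       : L.Carrier
    b∈M     : τ· b L.≈ b
    b≉0     : b L.≉ L.0#
    norms   : E⊂L.⟦ cyclicNorm E.rawRing 2 conj· a ⟧ L.≈ cyclicNorm L.rawRing 3 ρ· b

  a≉0 : a E.≉ E.0#
  a≉0 a≈0 = a∉𝔬F (F.0# , F.0-integral , E.trans F⊂E.0#-homo (E.sym a≈0))

module Construction {c ℓ} (S : Setting c ℓ) where
  open Setting S
  open Field L
  open RingHomomorphism E⊂L using (⟦_⟧)

  private
    pattern 0F = zero
    pattern 1F = suc zero
    pattern 2F = suc (suc zero)

  -- x stands for x₀ + x₁ z + x₂ z².  The product is determined by z³ = a and
  -- z l = ρ(l) z.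
  D : RawRing c ℓ
  D = record
    { Carrier = Vector Carrier 3
    ; _≈_     = λ x y → ∀ i → x i ≈ y i
    ; _+_     = λ x y i → x i + y i
    ; _*_     = λ x y →
        (x 0F * y 0F + ⟦ a ⟧ * (x 1F * ρ· (y 2F) + x 2F * ρ· (ρ· (y 1F)))) ∷
        (x 0F * y 1F + x 1F * ρ· (y 0F) + ⟦ a ⟧ * (x 2F * ρ· (ρ· (y 2F)))) ∷
        (x 0F * y 2F + x 1F * ρ· (y 1F) + x 2F * ρ· (ρ· (y 0F))) ∷ []
    ; -_      = λ x i → - x i
    ; 0#      = λ _ → 0#
    ; 1#      = 1# ∷ 0# ∷ 0# ∷ []
    }

  module D = RawRing D
  open SemiringDefs D.rawSemiring public using () renaming (_^_ to _^ᴰ_)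

  fromL : Carrier → D.Carrier
  fromL l = l ∷ 0# ∷ 0# ∷ []

  fromE : E.Carrier → D.Carrier
  fromE x = fromL ⟦ x ⟧

  z : D.Carrier
  z = 0# ∷ 1# ∷ 0# ∷ []

  αz : D.Carrier
  αz = fromL (b * ⟦ E.inverse a a≉0 ⟧) D.* (z ^ᴰ 2)

  -- The additive anti-multiplicative map with α|_L = τ and α(z) = (b/a) z²,
  -- so that α(l zⁱ) = α(z)ⁱ τ(l).
  α : D.Carrier → D.Carrier
  α x = fromL (τ· (x 0F)) D.+ (αz D.* fromL (τ· (x 1F))) D.+ ((αz ^ᴰ 2) D.* fromL (τ· (x 2F)))

  -- Right multiplication by g on the left L-vector space D with basis 1, z, z²
  -- gives the splitting D ⊗_E L ≅ M₃(L); row i is zⁱ g.  The determinant lies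
  -- in E and is regarded here as an element of L.
  Nrd : D.Carrier → Carrier
  Nrd g = det rawRing (λ (i j : Fin 3) → ((z ^ᴰ toℕ i) D.* g) j)

  𝕌 : D.Carrier → Set (c ⊔ ℓ)
  𝕌 g = Invertible D._≈_ D.1# D._*_ g × (α g D.* g) D.≈ D.1#

  𝔾 : D.Carrier → Set (c ⊔ ℓ)
  𝔾 g = 𝕌 g × Nrd g ≈ 1#

  IsFourthRootOfUnityInE : D.Carrier → Set (c ⊔ ℓ)
  IsFourthRootOfUnityInE g = ∃[ e ] (e E.^ 4) E.≈ E.1# × g D.≈ fromE e

{-# OPTIONS --safe #-}

-- If α(g) = ±g with α(g) g = 1 then g² = ±1.  Write g = x + y z + w z² and let T = x + ρx + ρ²x.
-- The coefficients of z and z² in g² vanish; if w were nonzero, this would make v = g - T satisfy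
-- z v = l v with l = ρ(y)/w in L, and then a v = z³ v = N(l) v, although a is not a norm.  Hence
-- w = 0, then y = 0, so that g = x lies in L.  Since x² = ±1 and ρ has order three, ρ fixes x, and
-- the fixed field of ρ is E.  On E the reduced norm is the cube, and a cube root of unity which is
-- also a fourth root of unity is 1.

module Submission where

open import Defs
open import Algebra.Bundles using (Group)
open import Algebra.Morphism.Bundles using (RingHomomorphism)
open import Algebra.Morphism.Structures using (IsRingMonomorphism)
open import Algebra.Apartness.Bundles using (HeytingField)
import Algebra.Apartness.Properties.HeytingCommutativeRing as HeytingProperties
import Algebra.Morphism.Construct.Composition as Composition
import Algebra.Properties.Group as GroupProperties
import Algebra.Properties.Monoid.Mult as MonoidMult
import Algebra.Properties.Monoid.Sum as MonoidSum
import Algebra.Properties.Ring as RingProperties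
import Algebra.Solver.Ring as RingSolver
open import Algebra.Solver.Ring.AlmostCommutativeRing
  using (fromCommutativeRing; _-Raw-AlmostCommutative⟶_)
open import Data.Empty using (⊥; ⊥-elim)
open import Data.Fin using (Fin; toℕ)
open import Data.Fin.Patterns using (0F; 1F; 2F; 3F; 4F; 5F)
open import Data.Fin.Properties using (all?)
import Data.Maybe as Maybe
open import Data.Nat using (zero; suc) renaming (_+_ to _+ℕ_)
open import Data.Product using (∃-syntax; _×_; _,_; proj₁; proj₂)
open import Data.Rational using (½) renaming (+-*-rawRing to ℚ-rawRing)
import Data.Rational.Properties as ℚ
open import Data.Sum as Sum using (_⊎_; inj₁; inj₂)
open import Function.Bundles using (_⇔_; mk⇔)
open import Relation.Binary.PropositionalEquality as ≡ using (_≡_)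
open import Relation.Binary.Definitions using (WeaklyDecidable)
import Relation.Binary.Reasoning.Setoid as SetoidReasoning
open import Relation.Nullary using (¬_; Dec; yes; no)
open import Relation.Nullary.Decidable using (dec⇒maybe; map′)

-- Arithmetic in a field containing the rational numbers.

module ℚ-Algebra {c ℓ} (K : Field c ℓ) (ιℚ : RingHomomorphism ℚ-rawRing (Field.rawRing K)) where
  open Field K
  open HeytingField heytingField using (heytingCommutativeRing; #-irrefl; #-cotrans; #⇒invertible; tight)
  open HeytingProperties heytingCommutativeRing using (1#0; x-0≈x)
  open RingProperties ring using (-‿involutive; -0#≈0#)
  open SetoidReasoning setoid
  private module ι = RingHomomorphism ιℚ

  private
    ℚ⟶K : ℚ-rawRing -Raw-AlmostCommutative⟶ fromCommutativeRing commutativeRing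
    ℚ⟶K = record
      { ⟦_⟧    = ι.⟦_⟧
      ; +-homo = ι.+-homo
      ; *-homo = ι.*-homo
      ; -‿homo = ι.-‿homo
      ; 0-homo = ι.0#-homo
      ; 1-homo = ι.1#-homo
      }

    -- The ring solver takes its coefficients in ℚ, where equality is decidable; equality in `K` is
    -- not assumed to be. Rational coefficients also admit the constant `½`.
    coefficients≟ : WeaklyDecidable (λ p q → ι.⟦ p ⟧ ≈ ι.⟦ q ⟧)
    coefficients≟ p q = Maybe.map ι.⟦⟧-cong (dec⇒maybe (p ℚ.≟ q))

  module Solver = RingSolver ℚ-rawRing (fromCommutativeRing commutativeRing) ℚ⟶K coefficients≟
  open Solver

  -- Tightness of the apartness relation. It licenses proofs of equations by contradiction in `L`,
  -- where no decision procedure for equality is given.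
  stable : ∀ {x y} → ¬ ¬ (x ≈ y) → x ≈ y
  stable ¬¬p = proj₁ (tight _ _) λ x#y → ¬¬p λ x≈y → #-irrefl x≈y x#y

  1≉0 : 1# ≉ 0#
  1≉0 p = #-irrefl p 1#0

  inverseʳ : ∀ {x} (x≉0 : x ≉ 0#) → x * inverse x x≉0 ≈ 1#
  inverseʳ {x} x≉0 = trans (*-congʳ (sym (x-0≈x x))) (proj₂ (proj₂ (#⇒invertible (≉⇒# x≉0))))

  x*y≈0⇒y≈0 : ∀ {x y} → x ≉ 0# → x * y ≈ 0# → y ≈ 0#
  x*y≈0⇒y≈0 {x} {y} x≉0 xy≈0 = begin
    y             ≈⟨ *-identityˡ y ⟨
    1# * y        ≈⟨ *-congʳ (inverseʳ x≉0) ⟨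
    (x * i) * y   ≈⟨ solve 3 (λ x i y → (x :* i) :* y := i :* (x :* y)) refl x i y ⟩
    i * (x * y)   ≈⟨ *-congˡ xy≈0 ⟩
    i * 0#        ≈⟨ zeroʳ i ⟩
    0#            ∎
    where i = inverse x x≉0

  x-y≈0⇒x≈y : ∀ {x y} → x - y ≈ 0# → x ≈ y
  x-y≈0⇒x≈y {x} {y} p = begin
    x           ≈⟨ solve 2 (λ x y → x := (x :- y) :+ y) refl x y ⟩
    (x - y) + y ≈⟨ +-congʳ p ⟩
    0# + y      ≈⟨ +-identityˡ y ⟩
    y           ∎

  x≈y⇒x-y≈0 : ∀ {x y} → x ≈ y → x - y ≈ 0#
  x≈y⇒x-y≈0 {x} {y} p = trans (+-congʳ p) (-‿inverseʳ y)

  x+y≈0⇒x≈-y : ∀ {x y} → x + y ≈ 0# → x ≈ - y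
  x+y≈0⇒x≈-y {x} {y} p = x-y≈0⇒x≈y (trans (+-congˡ (-‿involutive y)) p)

  *-cancelˡ : ∀ {x y z} → x ≉ 0# → x * y ≈ x * z → y ≈ z
  *-cancelˡ {x} {y} {z} x≉0 p = x-y≈0⇒x≈y (x*y≈0⇒y≈0 x≉0
    (trans (solve 3 (λ x y z → x :* (y :- z) := x :* y :- x :* z) refl x y z) (x≈y⇒x-y≈0 p)))

  half : Carrier
  half = ι.⟦ ½ ⟧

  half*[x+x]≈x : ∀ x → half * (x + x) ≈ x
  half*[x+x]≈x x = solve 1 (λ x → con ½ :* (x :+ x) := x) refl x

  x+x≈0⇒x≈0 : ∀ {x} → x + x ≈ 0# → x ≈ 0#
  x+x≈0⇒x≈0 {x} p = trans (sym (half*[x+x]≈x x)) (trans (*-congˡ p) (zeroʳ half))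

  x²≈y²⇒x≈-y : ∀ {x y} → x * x ≈ y * y → x ≉ y → x ≈ - y
  x²≈y²⇒x≈-y {x} {y} p x≉y = x+y≈0⇒x≈-y (x*y≈0⇒y≈0 (λ q → x≉y (x-y≈0⇒x≈y q))
    (trans (solve 2 (λ x y → (x :- y) :* (x :+ y) := x :* x :- y :* y) refl x y) (x≈y⇒x-y≈0 p)))

  -1*-1≈1 : - 1# * - 1# ≈ 1#
  -1*-1≈1 = trans (solve 1 (λ u → (:- u) :* (:- u) := u :* u) refl 1#) (*-identityˡ 1#)

  -- The case distinction comes from cotransitivity: 1 and -1 are apart because 2 is invertible, so
  -- `x` is apart from one of them and is therefore the other.
  x²≈1⇒x≈±1 : ∀ {x} → x * x ≈ 1# → x ≈ 1# ⊎ x ≈ - 1#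
  x²≈1⇒x≈±1 {x} p with #-cotrans (≉⇒# 1≉-1) x
    where
    1≉-1 : 1# ≉ - 1#
    1≉-1 q = 1≉0 (x+x≈0⇒x≈0 (trans (+-congˡ q) (-‿inverseʳ 1#)))
  ... | inj₁ 1#x  = inj₂ (x²≈y²⇒x≈-y (trans p (sym (*-identityˡ 1#))) λ q → #-irrefl (sym q) 1#x)
  ... | inj₂ x#-1 = inj₁ (trans (x²≈y²⇒x≈-y (trans p (sym -1*-1≈1)) λ q → #-irrefl q x#-1)
                                (-‿involutive 1#))

  -- An automorphism of order three: squares in the cyclic algebra and norms.

  module Cubic {σ : Carrier → Carrier} (σ-mono : IsRingMonomorphism rawRing rawRing σ)
               (σ³≈id : ∀ x → σ (σ (σ x)) ≈ x) where
    private module σ = IsRingMonomorphism σ-mono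

    -- The last two hypotheses say that z and z² have coefficient 0 in (x + y z + w z²)².
    module _ {a x y w : Carrier} (σa≈a : σ a ≈ a) (a≉0 : a ≉ 0#)
             (coeff₁ : x * y + y * σ x + a * (w * σ (σ w)) ≈ 0#)
             (coeff₂ : x * w + y * σ y + w * σ (σ x) ≈ 0#) where

      w≉0⇒a∈N : w ≉ 0# → ∃[ l ] l ≉ 0# × cyclicNorm rawRing 3 σ l ≈ a
      w≉0⇒a∈N w≉0 = l , l≉0 , Nl≈a
        where
        x′ x″ y′ y″ w′ w″ : Carrier
        x′ = σ x
        x″ = σ x′
        y′ = σ y
        y″ = σ y′
        w′ = σ w
        w″ = σ w′

        i l l′ l″ : Carrier
        i = inverse w w≉0
        l = i * y′
        l′ = σ l
        l″ = σ l′

        -- ly≈, wl≈y′ and l[x-T]≈aw′ are the three coefficients of z v = l v.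
        wl≈y′ : w * l ≈ y′
        wl≈y′ = begin
          w * (i * y′) ≈⟨ *-assoc w i y′ ⟨
          (w * i) * y′ ≈⟨ *-congʳ (inverseʳ w≉0) ⟩
          1# * y′      ≈⟨ *-identityˡ y′ ⟩
          y′           ∎

        w′l′≈y″ : w′ * l′ ≈ y″
        w′l′≈y″ = trans (sym (σ.*-homo w l)) (σ.⟦⟧-cong wl≈y′)

        ly≈ : l * y ≈ - (x + x″)
        ly≈ = *-cancelˡ w≉0 (begin
          w * (l * y)        ≈⟨ *-assoc w l y ⟨
          (w * l) * y        ≈⟨ *-congʳ wl≈y′ ⟩
          y′ * y             ≈⟨ solve 5 (λ x x″ y y′ w → y′ :* y :=
                                  (x :* w :+ y :* y′ :+ w :* x″) :+ w :* (:- (x :+ x″))) refl x x″ y y′ w ⟩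
          (x * w + y * y′ + w * x″) + w * - (x + x″) ≈⟨ +-congʳ coeff₂ ⟩
          0# + w * - (x + x″) ≈⟨ +-identityˡ _ ⟩
          w * - (x + x″) ∎)

        σσ-ly≈ : l″ * y″ ≈ - (x′ + x″)
        σσ-ly≈ = begin
          l″ * y″            ≈⟨ σ.*-homo l′ y′ ⟨
          σ (l′ * y′)        ≈⟨ σ.⟦⟧-cong (σ.*-homo l y) ⟨
          σ (σ (l * y))      ≈⟨ σ.⟦⟧-cong (σ.⟦⟧-cong ly≈) ⟩
          σ (σ (- (x + x″))) ≈⟨ σ.⟦⟧-cong (σ.-‿homo _) ⟩
          σ (- σ (x + x″))   ≈⟨ σ.-‿homo _ ⟩
          - σ (σ (x + x″))   ≈⟨ -‿cong (σ.⟦⟧-cong (trans (σ.+-homo _ _) (+-congˡ (σ³≈id x)))) ⟩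
          - σ (x′ + x)       ≈⟨ -‿cong (trans (σ.+-homo _ _) (+-comm _ _)) ⟩
          - (x′ + x″)        ∎

        -- Applying `σ` makes `y′` a common factor of the first two terms, and `y′` is `w * l`.
        σ-coeff₁ : x′ * y′ + y′ * x″ + a * (w′ * w) ≈ 0#
        σ-coeff₁ = begin
          x′ * y′ + y′ * x″ + a * (w′ * w)
            ≈⟨ +-cong (+-cong (σ.*-homo _ _) (σ.*-homo _ _))
                 (trans (σ.*-homo _ _) (*-cong σa≈a (trans (σ.*-homo _ _) (*-congˡ (σ³≈id w))))) ⟨
          σ (x * y) + σ (y * x′) + σ (a * (w * w″)) ≈⟨ +-congʳ (σ.+-homo _ _) ⟨
          σ (x * y + y * x′) + σ (a * (w * w″))     ≈⟨ σ.+-homo _ _ ⟨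
          σ (x * y + y * x′ + a * (w * w″))         ≈⟨ σ.⟦⟧-cong coeff₁ ⟩
          σ 0#                                      ≈⟨ σ.0#-homo ⟩
          0#                                        ∎

        l[x-T]≈aw′ : l * - (x′ + x″) ≈ a * w′
        l[x-T]≈aw′ = *-cancelˡ w≉0 (begin
          w * (l * - (x′ + x″))  ≈⟨ *-assoc w l _ ⟨
          (w * l) * - (x′ + x″)  ≈⟨ *-congʳ wl≈y′ ⟩
          y′ * - (x′ + x″)
            ≈⟨ solve 6 (λ x′ x″ y′ w w′ a → y′ :* (:- (x′ :+ x″)) :=
                 :- (x′ :* y′ :+ y′ :* x″ :+ a :* (w′ :* w)) :+ w :* (a :* w′)) refl x′ x″ y′ w w′ a ⟩
          - (x′ * y′ + y′ * x″ + a * (w′ * w)) + w * (a * w′) ≈⟨ +-congʳ (trans (-‿cong σ-coeff₁) -0#≈0#) ⟩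
          0# + w * (a * w′)      ≈⟨ +-identityˡ _ ⟩
          w * (a * w′)           ∎)

        -- This replaces the comparison of `z³ v` with `N(l) v`. Starting from `w′`, the relations
        -- for the coefficients of `z²`, `z` and 1, taken after `σ`, `σ²` and the identity, turn
        -- `w′` into `y″`, then into `x - T`, then into `a * w′`, each at the cost of one conjugate
        -- of `l`. The factor `1#` is the empty product at the end of `cyclicNorm`.
        Nl≈a : l * (l′ * (l″ * 1#)) ≈ a
        Nl≈a = *-cancelˡ (λ w′≈0 → w≉0 (σ.injective (trans w′≈0 (sym σ.0#-homo)))) (begin
          w′ * (l * (l′ * (l″ * 1#)))
            ≈⟨ *-congˡ (*-congˡ (*-congˡ (*-identityʳ l″))) ⟩
          w′ * (l * (l′ * l″))
            ≈⟨ solve 4 (λ w′ l l′ l″ → w′ :* (l :* (l′ :* l″)) := l :* (l″ :* (w′ :* l′))) refl w′ l l′ l″ ⟩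
          l * (l″ * (w′ * l′))  ≈⟨ *-congˡ (*-congˡ w′l′≈y″) ⟩
          l * (l″ * y″)         ≈⟨ *-congˡ σσ-ly≈ ⟩
          l * - (x′ + x″)       ≈⟨ l[x-T]≈aw′ ⟩
          a * w′                ≈⟨ *-comm a w′ ⟩
          w′ * a                ∎)

        l≉0 : l ≉ 0#
        l≉0 l≈0 = a≉0 (trans (sym Nl≈a) (trans (*-congʳ l≈0) (zeroˡ _)))

      -- Without `w` the coefficient of `z²` reduces to `y * σ y`; if `y` were nonzero, `σ y` would
      -- vanish, against the injectivity of `σ`.
      w≈0⇒y≈0 : w ≈ 0# → y ≈ 0#
      w≈0⇒y≈0 w≈0 = stable λ y≉0 → y≉0 (σ.injective (trans (x*y≈0⇒y≈0 y≉0 yy′≈0) (sym σ.0#-homo)))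
        where
        yy′≈0 : y * σ y ≈ 0#
        yy′≈0 = begin
          y * σ y
            ≈⟨ solve 4 (λ x x″ u w → u := (x :* w :+ u :+ w :* x″) :- w :* (x :+ x″))
                 refl x (σ (σ x)) (y * σ y) w ⟩
          (x * w + y * σ y + w * σ (σ x)) - w * (x + σ (σ x))
            ≈⟨ x≈y⇒x-y≈0 (trans coeff₂ (sym (trans (*-congʳ w≈0) (zeroˡ _)))) ⟩
          0# ∎

    -- `σ` fixes the square of `x`, so if it moved `x` it would negate it. As `σ` has odd order,
    -- this forces `x = -x`, hence `x = 0`, which is fixed after all.
    x²≈±1⇒σx≈x : ∀ {x} → (x * x ≈ 1# ⊎ x * x ≈ - 1#) → σ x ≈ x
    x²≈±1⇒σx≈x {x} h = stable λ σx≉x →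
      let σx≈-x = x²≈y²⇒x≈-y (trans (sym (σ.*-homo x x)) (σ[x²]≈x² h)) σx≉x
          x≈-x  = begin
            x                ≈⟨ σ³≈id x ⟨
            σ (σ (σ x))      ≈⟨ σ.⟦⟧-cong (σ.⟦⟧-cong σx≈-x) ⟩
            σ (σ (- x))      ≈⟨ σ.⟦⟧-cong (trans (σ.-‿homo x) (trans (-‿cong σx≈-x) (-‿involutive x))) ⟩
            σ x              ≈⟨ σx≈-x ⟩
            - x              ∎
          x≈0 = x+x≈0⇒x≈0 (trans (+-congˡ x≈-x) (-‿inverseʳ x))
      in σx≉x (trans (σ.⟦⟧-cong x≈0) (trans σ.0#-homo (sym x≈0)))
      where
      σ[x²]≈x² : (x * x ≈ 1# ⊎ x * x ≈ - 1#) → σ (x * x) ≈ x * x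
      σ[x²]≈x² (inj₁ p) = trans (σ.⟦⟧-cong p) (trans σ.1#-homo (sym p))
      σ[x²]≈x² (inj₂ p) = trans (σ.⟦⟧-cong p)
        (trans (σ.-‿homo 1#) (trans (-‿cong σ.1#-homo) (sym p)))

-- Decidable equality in number fields and injectivity of field homomorphisms.

module _ {c ℓ} (K : NumberField c ℓ) where
  open NumberField K
  private module ι = RingHomomorphism ιℚ

  -- Coordinates in a basis over ℚ are unique, so finitely many comparisons of rational numbers
  -- decide equality.
  numberField-≟ : ∀ x y → Dec (x ≈ y)
  numberField-≟ x y with finite
  ... | n , v , basis with basis x | basis y
  ... | p , p≈x , _ | q , q≈y , q-unique = map′
    (λ p≡q → trans (sym p≈x) (trans (sum-cong-≋ λ i → *-congʳ (ι.⟦⟧-cong (p≡q i))) q≈y))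
    (λ x≈y i → ≡.sym (q-unique (trans p≈x x≈y) i))
    (all? λ i → p i ℚ.≟ q i)
    where open MonoidSum +-monoid using (sum-cong-≋)

module _ {c ℓ} {K K′ : Field c ℓ} (f : RingHomomorphism (Field.rawRing K) (Field.rawRing K′))
         (ιℚ : RingHomomorphism ℚ-rawRing (Field.rawRing K))
         (ιℚ′ : RingHomomorphism ℚ-rawRing (Field.rawRing K′)) where
  private
    module K  = Field K
    module K′ = Field K′
    module A  = ℚ-Algebra K ιℚ
    module A′ = ℚ-Algebra K′ ιℚ′
  open RingHomomorphism f

  fieldHomo-≈0 : ∀ {x} → ⟦ x ⟧ K′.≈ K′.0# → x K.≈ K.0#
  fieldHomo-≈0 {x} fx≈0 = A.stable λ x≉0 → A′.1≉0 (begin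
    K′.1#                              ≈⟨ 1#-homo ⟨
    ⟦ K.1# ⟧                           ≈⟨ ⟦⟧-cong (A.inverseʳ x≉0) ⟨
    ⟦ x K.* K.inverse x x≉0 ⟧          ≈⟨ *-homo _ _ ⟩
    ⟦ x ⟧ K′.* ⟦ K.inverse x x≉0 ⟧     ≈⟨ K′.*-congʳ fx≈0 ⟩
    K′.0# K′.* ⟦ K.inverse x x≉0 ⟧     ≈⟨ K′.zeroˡ _ ⟩
    K′.0#                              ∎)
    where open SetoidReasoning K′.setoid

  fieldHomo-injective : ∀ {x y} → ⟦ x ⟧ K′.≈ ⟦ y ⟧ → x K.≈ y
  fieldHomo-injective p = A.x-y≈0⇒x≈y (fieldHomo-≈0
    (K′.trans (+-homo _ _) (K′.trans (K′.+-congˡ (-‿homo _)) (A′.x≈y⇒x-y≈0 p))))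

-- Quadratic extensions: a generator negated by conjugation.

module QuadraticExtension {c ℓ} (F E : NumberField c ℓ)
  (ι : RingHomomorphism (NumberField.rawRing F) (NumberField.rawRing E))
  (quadratic : HasDegree ι 2)
  (conj : Automorphism {K = NumberField.asField F} {L = NumberField.asField E} ι)
  (conj≉id : ¬ (∀ x → NumberField._≈_ E (Automorphism.ap conj x) x))
  (conj-involutive : ∀ x → NumberField._≈_ E (Automorphism.ap conj (Automorphism.ap conj x)) x)
  where
  private
    module F = NumberField F
    module σ = Automorphism conj
    module AF = ℚ-Algebra (NumberField.asField F) F.ιℚ
  open NumberField E
  open ℚ-Algebra asField ιℚ
  open RingHomomorphism ι
  open SetoidReasoning setoid
  open Solver using (solve; _:=_; _:+_; _:*_; _:-_; :-_)

  σ : Carrier → Carrier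
  σ = σ.ap

  private
    v₀ v₁ : Carrier
    v₀ = proj₁ quadratic 0F
    v₁ = proj₁ quadratic 1F

    coordinates : ∀ x → ∃[ p ] ∃[ q ] ⟦ p ⟧ * v₀ + ⟦ q ⟧ * v₁ ≈ x
    coordinates x with proj₂ quadratic x
    ... | p , p≈x , _ = p 0F , p 1F , trans (+-congˡ (sym (+-identityʳ _))) p≈x

  σ-linear : ∀ p x → σ (⟦ p ⟧ * x) ≈ ⟦ p ⟧ * σ x
  σ-linear p x = trans (σ.*-homo _ _) (*-congʳ (σ.fixes p))

  difference : ∀ v → σ v ≉ v → ∃[ δ ] δ ≉ 0# × σ δ ≈ - δ
  difference v σv≉v = σ v - v , (λ p → σv≉v (x-y≈0⇒x≈y p)) , (begin
    σ (σ v - v)        ≈⟨ σ.+-homo _ _ ⟩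
    σ (σ v) + σ (- v)  ≈⟨ +-cong (conj-involutive v) (σ.-‿homo v) ⟩
    v - σ v            ≈⟨ solve 2 (λ v u → v :- u := :- (u :- v)) refl v (σ v) ⟩
    - (σ v - v)        ∎)

  -- By linearity over `F`, a conjugation fixing both basis vectors would be the identity. Decidable
  -- equality in `E` finds a basis vector `v` that is moved, and `σ v - v` is negated.
  antiFixed : ∃[ δ ] δ ≉ 0# × σ δ ≈ - δ
  antiFixed with numberField-≟ E (σ v₀) v₀ | numberField-≟ E (σ v₁) v₁
  ... | no ≉ | _ = difference v₀ ≉
  ... | yes _ | no ≉ = difference v₁ ≉
  ... | yes ≈₀ | yes ≈₁ = ⊥-elim (conj≉id fixed)
    where
    fixed : ∀ x → σ x ≈ x
    fixed x with coordinates x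
    ... | p , q , ≈x = begin
      σ x                                ≈⟨ σ.⟦⟧-cong ≈x ⟨
      σ (⟦ p ⟧ * v₀ + ⟦ q ⟧ * v₁)        ≈⟨ σ.+-homo _ _ ⟩
      σ (⟦ p ⟧ * v₀) + σ (⟦ q ⟧ * v₁)    ≈⟨ +-cong (σ-linear p v₀) (σ-linear q v₁) ⟩
      ⟦ p ⟧ * σ v₀ + ⟦ q ⟧ * σ v₁        ≈⟨ +-cong (*-congˡ ≈₀) (*-congˡ ≈₁) ⟩
      ⟦ p ⟧ * v₀ + ⟦ q ⟧ * v₁            ≈⟨ ≈x ⟩
      x                                  ∎

  module _ {δ : Carrier} (δ≉0 : δ ≉ 0#) (σδ≈-δ : σ δ ≈ - δ) where

    σ[p+qδ]≈p-qδ : ∀ p q → σ (⟦ p ⟧ + ⟦ q ⟧ * δ) ≈ ⟦ p ⟧ - ⟦ q ⟧ * δ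
    σ[p+qδ]≈p-qδ p q = begin
      σ (⟦ p ⟧ + ⟦ q ⟧ * δ)   ≈⟨ σ.+-homo _ _ ⟩
      σ ⟦ p ⟧ + σ (⟦ q ⟧ * δ) ≈⟨ +-cong (σ.fixes p) (trans (σ-linear q δ) (*-congˡ σδ≈-δ)) ⟩
      ⟦ p ⟧ + ⟦ q ⟧ * - δ     ≈⟨ solve 3 (λ p q δ → p :+ q :* (:- δ) := p :- q :* δ) refl ⟦ p ⟧ ⟦ q ⟧ δ ⟩
      ⟦ p ⟧ - ⟦ q ⟧ * δ       ∎

    σ-fixed⇒qδ≈0 : ∀ p q → σ (⟦ p ⟧ + ⟦ q ⟧ * δ) ≈ ⟦ p ⟧ + ⟦ q ⟧ * δ → ⟦ q ⟧ * δ ≈ 0#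
    σ-fixed⇒qδ≈0 p q fixed = x+x≈0⇒x≈0 (begin
      ⟦ q ⟧ * δ + ⟦ q ⟧ * δ
        ≈⟨ solve 2 (λ p u → u :+ u := (p :+ u) :- (p :- u)) refl ⟦ p ⟧ (⟦ q ⟧ * δ) ⟩
      (⟦ p ⟧ + ⟦ q ⟧ * δ) - (⟦ p ⟧ - ⟦ q ⟧ * δ)
        ≈⟨ x≈y⇒x-y≈0 (trans (sym fixed) (σ[p+qδ]≈p-qδ p q)) ⟩
      0# ∎)

    -- Zero is fixed by `σ`, so the component along `δ` vanishes, and then so does the other one.
    1,δ-independent : ∀ p q → ⟦ p ⟧ + ⟦ q ⟧ * δ ≈ 0# → p F.≈ F.0# × q F.≈ F.0#
    1,δ-independent p q h = ι-≈0 p≈0 , ι-≈0 (x*y≈0⇒y≈0 δ≉0 (trans (*-comm _ _) qδ≈0))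
      where
      ι-≈0 : ∀ {x} → ⟦ x ⟧ ≈ 0# → x F.≈ F.0#
      ι-≈0 = fieldHomo-≈0 {K = NumberField.asField F} {K′ = asField} ι F.ιℚ ιℚ
      qδ≈0 : ⟦ q ⟧ * δ ≈ 0#
      qδ≈0 = σ-fixed⇒qδ≈0 p q (trans (σ.⟦⟧-cong h) (trans σ.0#-homo (sym h)))
      p≈0 : ⟦ p ⟧ ≈ 0#
      p≈0 = trans (trans (sym (+-identityʳ _)) (+-congˡ (sym qδ≈0))) h

    -- The square of `δ` is fixed by `σ`, since the two signs cancel; so it has no component along
    -- `δ`.
    δ²≈p+qδ⇒δ²≈p : ∀ p q → δ * δ ≈ ⟦ p ⟧ + ⟦ q ⟧ * δ → δ * δ ≈ ⟦ p ⟧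
    δ²≈p+qδ⇒δ²≈p p q h = trans h (trans (+-congˡ (σ-fixed⇒qδ≈0 p q (begin
      σ (⟦ p ⟧ + ⟦ q ⟧ * δ) ≈⟨ σ.⟦⟧-cong h ⟨
      σ (δ * δ)             ≈⟨ σ.*-homo δ δ ⟩
      σ δ * σ δ             ≈⟨ *-cong σδ≈-δ σδ≈-δ ⟩
      - δ * - δ             ≈⟨ solve 1 (λ δ → (:- δ) :* (:- δ) := δ :* δ) refl δ ⟩
      δ * δ                 ≈⟨ h ⟩
      ⟦ p ⟧ + ⟦ q ⟧ * δ     ∎))) (+-identityʳ _))

    private
      det₂ : F.Carrier → F.Carrier → F.Carrier → F.Carrier → F.Carrier
      det₂ p q r s = p F.* s F.- q F.* r

      ⟦det₂⟧ : ∀ p q r s → ⟦ det₂ p q r s ⟧ ≈ ⟦ p ⟧ * ⟦ s ⟧ - ⟦ q ⟧ * ⟦ r ⟧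
      ⟦det₂⟧ p q r s = trans (+-homo _ _) (+-cong (*-homo p s) (trans (-‿homo _) (-‿cong (*-homo q r))))

      -- Cramer's rule for three vectors of F².
      cramer : ∀ {x y z p₀ p₁ q₀ q₁ r₀ r₁} →
        ⟦ p₀ ⟧ * v₀ + ⟦ p₁ ⟧ * v₁ ≈ x → ⟦ q₀ ⟧ * v₀ + ⟦ q₁ ⟧ * v₁ ≈ y → ⟦ r₀ ⟧ * v₀ + ⟦ r₁ ⟧ * v₁ ≈ z →
        ⟦ det₂ p₀ p₁ q₀ q₁ ⟧ * z ≈ ⟦ det₂ r₀ r₁ q₀ q₁ ⟧ * x + ⟦ det₂ p₀ p₁ r₀ r₁ ⟧ * y
      cramer {x} {y} {z} {p₀} {p₁} {q₀} {q₁} {r₀} {r₁} p≈x q≈y r≈z = begin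
        ⟦ det₂ p₀ p₁ q₀ q₁ ⟧ * z ≈⟨ *-cong (⟦det₂⟧ _ _ _ _) (sym r≈z) ⟩
        (⟦ p₀ ⟧ * ⟦ q₁ ⟧ - ⟦ p₁ ⟧ * ⟦ q₀ ⟧) * (⟦ r₀ ⟧ * v₀ + ⟦ r₁ ⟧ * v₁)
          ≈⟨ solve 8 (λ p₀ p₁ q₀ q₁ r₀ r₁ v₀ v₁ →
               (p₀ :* q₁ :- p₁ :* q₀) :* (r₀ :* v₀ :+ r₁ :* v₁) :=
               (r₀ :* q₁ :- r₁ :* q₀) :* (p₀ :* v₀ :+ p₁ :* v₁) :+
               (p₀ :* r₁ :- p₁ :* r₀) :* (q₀ :* v₀ :+ q₁ :* v₁))
             refl ⟦ p₀ ⟧ ⟦ p₁ ⟧ ⟦ q₀ ⟧ ⟦ q₁ ⟧ ⟦ r₀ ⟧ ⟦ r₁ ⟧ v₀ v₁ ⟩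
        (⟦ r₀ ⟧ * ⟦ q₁ ⟧ - ⟦ r₁ ⟧ * ⟦ q₀ ⟧) * (⟦ p₀ ⟧ * v₀ + ⟦ p₁ ⟧ * v₁) +
        (⟦ p₀ ⟧ * ⟦ r₁ ⟧ - ⟦ p₁ ⟧ * ⟦ r₀ ⟧) * (⟦ q₀ ⟧ * v₀ + ⟦ q₁ ⟧ * v₁)
          ≈⟨ +-cong (*-cong (sym (⟦det₂⟧ _ _ _ _)) p≈x) (*-cong (sym (⟦det₂⟧ _ _ _ _)) q≈y) ⟩
        ⟦ det₂ r₀ r₁ q₀ q₁ ⟧ * x + ⟦ det₂ p₀ p₁ r₀ r₁ ⟧ * y ∎

    -- Change of basis from `v₀`, `v₁` to 1, `δ`. Cramer's rule writes `d * x` in terms of 1 and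
    -- `δ`, where `d` is the determinant of their coordinates; if `d` vanished, both coordinates of
    -- 1 would be zero.
    F+Fδ : ∀ x → ∃[ p ] ∃[ q ] x ≈ ⟦ p ⟧ + ⟦ q ⟧ * δ
    F+Fδ x with coordinates 1# | coordinates δ | coordinates x
    ... | p₀ , p₁ , ≈1 | q₀ , q₁ , ≈δ | r₀ , r₁ , ≈x = s F.* d′ , s F.* d″ , (begin
      x                                 ≈⟨ *-identityˡ x ⟨
      1# * x                            ≈⟨ *-congʳ s*d≈1 ⟨
      ⟦ s ⟧ * ⟦ d ⟧ * x                 ≈⟨ *-assoc _ _ x ⟩
      ⟦ s ⟧ * (⟦ d ⟧ * x)               ≈⟨ *-congˡ (trans (cramer ≈1 ≈δ ≈x) (+-congʳ (*-identityʳ _))) ⟩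
      ⟦ s ⟧ * (⟦ d′ ⟧ + ⟦ d″ ⟧ * δ)     ≈⟨ solve 4 (λ s d e δ → s :* (d :+ e :* δ) := s :* d :+ s :* e :* δ)
                                             refl ⟦ s ⟧ ⟦ d′ ⟧ ⟦ d″ ⟧ δ ⟩
      ⟦ s ⟧ * ⟦ d′ ⟧ + ⟦ s ⟧ * ⟦ d″ ⟧ * δ ≈⟨ +-cong (*-homo _ _) (*-congʳ (*-homo _ _)) ⟨
      ⟦ s F.* d′ ⟧ + ⟦ s F.* d″ ⟧ * δ   ∎)
      where
      d d′ d″ : F.Carrier
      d  = det₂ p₀ p₁ q₀ q₁
      d′ = det₂ r₀ r₁ q₀ q₁
      d″ = det₂ p₀ p₁ r₀ r₁

      module _ (d≈0 : d F.≈ F.0#) where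
        det≈0 : ⟦ p₀ ⟧ * ⟦ q₁ ⟧ - ⟦ p₁ ⟧ * ⟦ q₀ ⟧ ≈ 0#
        det≈0 = trans (sym (⟦det₂⟧ _ _ _ _)) (trans (⟦⟧-cong d≈0) 0#-homo)

        -- Meant for `p` and `q` the coordinates of 1 and of `δ` at the same basis vector. In
        -- `p δ - q` that basis vector cancels and the other one carries the determinant up to sign,
        -- so a vanishing determinant gives a linear relation between 1 and `δ`.
        coordinate-of-1≈0 : ∀ {p q v} →
          ⟦ p ⟧ * (⟦ q₀ ⟧ * v₀ + ⟦ q₁ ⟧ * v₁) - ⟦ q ⟧ * (⟦ p₀ ⟧ * v₀ + ⟦ p₁ ⟧ * v₁) ≈
            (⟦ p₀ ⟧ * ⟦ q₁ ⟧ - ⟦ p₁ ⟧ * ⟦ q₀ ⟧) * v →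
          p F.≈ F.0#
        coordinate-of-1≈0 {p} {q} {v} h = proj₂ (1,δ-independent (F.- q) p (begin
          ⟦ F.- q ⟧ + ⟦ p ⟧ * δ       ≈⟨ +-congʳ (-‿homo q) ⟩
          - ⟦ q ⟧ + ⟦ p ⟧ * δ         ≈⟨ +-comm _ _ ⟩
          ⟦ p ⟧ * δ - ⟦ q ⟧           ≈⟨ +-congˡ (-‿cong (*-identityʳ _)) ⟨
          ⟦ p ⟧ * δ - ⟦ q ⟧ * 1#      ≈⟨ +-cong (*-congˡ ≈δ) (-‿cong (*-congˡ ≈1)) ⟨
          ⟦ p ⟧ * (⟦ q₀ ⟧ * v₀ + ⟦ q₁ ⟧ * v₁) - ⟦ q ⟧ * (⟦ p₀ ⟧ * v₀ + ⟦ p₁ ⟧ * v₁) ≈⟨ h ⟩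
          (⟦ p₀ ⟧ * ⟦ q₁ ⟧ - ⟦ p₁ ⟧ * ⟦ q₀ ⟧) * v ≈⟨ trans (*-congʳ det≈0) (zeroˡ v) ⟩
          0#                          ∎))

        p₀≈0 : p₀ F.≈ F.0#
        p₀≈0 = coordinate-of-1≈0 (solve 6 (λ p₀ p₁ q₀ q₁ v₀ v₁ →
          p₀ :* (q₀ :* v₀ :+ q₁ :* v₁) :- q₀ :* (p₀ :* v₀ :+ p₁ :* v₁) := (p₀ :* q₁ :- p₁ :* q₀) :* v₁)
          refl ⟦ p₀ ⟧ ⟦ p₁ ⟧ ⟦ q₀ ⟧ ⟦ q₁ ⟧ v₀ v₁)

        p₁≈0 : p₁ F.≈ F.0#
        p₁≈0 = coordinate-of-1≈0 (solve 6 (λ p₀ p₁ q₀ q₁ v₀ v₁ →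
          p₁ :* (q₀ :* v₀ :+ q₁ :* v₁) :- q₁ :* (p₀ :* v₀ :+ p₁ :* v₁) := (p₀ :* q₁ :- p₁ :* q₀) :* (:- v₀))
          refl ⟦ p₀ ⟧ ⟦ p₁ ⟧ ⟦ q₀ ⟧ ⟦ q₁ ⟧ v₀ v₁)

        p≈0⇒pv≈0 : ∀ {p} v → p F.≈ F.0# → ⟦ p ⟧ * v ≈ 0#
        p≈0⇒pv≈0 v p≈0 = trans (*-congʳ (trans (⟦⟧-cong p≈0) 0#-homo)) (zeroˡ v)

        absurd : ⊥
        absurd = 1≉0 (trans (sym ≈1) (trans (+-cong (p≈0⇒pv≈0 v₀ p₀≈0) (p≈0⇒pv≈0 v₁ p₁≈0)) (+-identityˡ 0#)))

      s : F.Carrier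
      s = F.inverse d absurd

      s*d≈1 : ⟦ s ⟧ * ⟦ d ⟧ ≈ 1#
      s*d≈1 = trans (sym (*-homo s d)) (trans (⟦⟧-cong (F.trans (F.*-comm s d) (AF.inverseʳ absurd))) 1#-homo)

    δ²∈F : ∃[ p ] δ * δ ≈ ⟦ p ⟧
    δ²∈F = let p , q , h = F+Fδ (δ * δ) in p , δ²≈p+qδ⇒δ²≈p p q h

-- The cyclic group of order six.

module CyclicOfOrder6 {c ℓ} (G : Group c ℓ) (cyclic : IsCyclicOfOrder G 6) where
  open Group G
  open GroupProperties G using (∙-cancelˡ)
  open MonoidMult monoid using (×-homo-+) renaming (_×_ to _times_)

  γ : Carrier
  γ = proj₁ cyclic

  private
    powers-distinct : ∀ {i j : Fin 6} → toℕ i times γ ≈ toℕ j times γ → i ≡ j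
    powers-distinct = proj₁ (proj₂ cyclic)

  isPower : ∀ g → ∃[ k ] toℕ {6} k times γ ≈ g
  isPower g = let k , p = proj₂ (proj₂ cyclic) g in k , p ≡.refl

  -- The definition of cyclicity only says that the exponents 0 to 5 enumerate the group. So `γ⁶` is
  -- some `γᵏ` with `k < 6`, and for `k > 0` cancellation would make the smaller power `γ⁶⁻ᵏ`
  -- trivial, against injectivity.
  γ⁶≈ε : 6 times γ ≈ ε
  γ⁶≈ε with isPower (6 times γ)
  ... | k , γᵏ≈γ⁶ = no-smaller k γᵏ≈γ⁶
    where
    cancel : ∀ i j → i times γ ≈ (i +ℕ j) times γ → j times γ ≈ ε
    cancel i j p = sym (∙-cancelˡ (i times γ) _ _
      (trans (identityʳ _) (trans p (×-homo-+ γ i j))))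

    no-smaller : ∀ (k : Fin 6) → toℕ k times γ ≈ 6 times γ → 6 times γ ≈ ε
    no-smaller 0F p = sym p
    no-smaller 1F p with () ← powers-distinct {5F} {0F} (cancel 1 5 p)
    no-smaller 2F p with () ← powers-distinct {4F} {0F} (cancel 2 4 p)
    no-smaller 3F p with () ← powers-distinct {3F} {0F} (cancel 3 3 p)
    no-smaller 4F p with () ← powers-distinct {2F} {0F} (cancel 4 2 p)
    no-smaller 5F p with () ← powers-distinct {1F} {0F} (cancel 5 1 p)

  γⁿ⁺⁶≈γⁿ : ∀ n → (6 +ℕ n) times γ ≈ n times γ
  γⁿ⁺⁶≈γⁿ n = trans (×-homo-+ γ 6 n) (trans (∙-congʳ γ⁶≈ε) (identityˡ _))

  -- Among the exponents 0 to 5 only 0 and 3 double to a multiple of 6, and 0 gives the identity.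
  -- The doubles 8 and 10 are first reduced to 2 and 4.
  involution≈γ³ : ∀ t → ¬ t ≈ ε → t ∙ t ≈ ε → 3 times γ ≈ t
  involution≈γ³ t t≉ε t²≈ε with isPower t
  ... | k , γᵏ≈t = go k γᵏ≈t
    where
    square : ∀ k → k times γ ≈ t → (k +ℕ k) times γ ≈ ε
    square k p = trans (×-homo-+ γ k k) (trans (∙-cong p p) t²≈ε)

    go : ∀ (k : Fin 6) → toℕ k times γ ≈ t → 3 times γ ≈ t
    go 0F p = ⊥-elim (t≉ε (sym p))
    go 1F p with () ← powers-distinct {2F} {0F} (square 1 p)
    go 2F p with () ← powers-distinct {4F} {0F} (square 2 p)
    go 3F p = p
    go 4F p with () ← powers-distinct {2F} {0F} (trans (sym (γⁿ⁺⁶≈γⁿ 2)) (square 4 p))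
    go 5F p with () ← powers-distinct {4F} {0F} (trans (sym (γⁿ⁺⁶≈γⁿ 4)) (square 5 p))

-- The action of Gal(L/F) on `E`, the fixed field of `ρ` and its order.

module _ {c ℓ} {K L : Field c ℓ} (ι : RingHomomorphism (Field.rawRing K) (Field.rawRing L)) where
  open Field L
  open MonoidMult (Group.monoid (Gal {K = K} {L = L} ι)) using () renaming (_×_ to _times_)

  powers-fix : ∀ (σ : Automorphism {K = K} {L = L} ι) {x} → Automorphism.ap σ x ≈ x →
               ∀ n → Automorphism.ap (n times σ) x ≈ x
  powers-fix σ σx≈x zero    = refl
  powers-fix σ σx≈x (suc n) = trans (Automorphism.⟦⟧-cong σ (powers-fix σ σx≈x n)) σx≈x

module GaloisAction {c ℓ} (S : Setting c ℓ) where
  open Setting S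
  open Field L
  open SetoidReasoning setoid
  open RingProperties ring using (-‿involutive)

  ιℚ : RingHomomorphism ℚ-rawRing rawRing
  ιℚ = record { isRingHomomorphism = Composition.isRingHomomorphism trans
    (RingHomomorphism.isRingHomomorphism E.ιℚ) (RingHomomorphism.isRingHomomorphism E⊂L) }

  open ℚ-Algebra L ιℚ
  open Solver using (solve; _:=_; _:+_; _:*_; _:-_; :-_)
  private
    module τ = Automorphism τ
    module ρ = Automorphism ρ
    module ι = RingHomomorphism E⊂L

  E⊂L-injective : ∀ {x y} → ι.⟦ x ⟧ ≈ ι.⟦ y ⟧ → x E.≈ y
  E⊂L-injective = fieldHomo-injective {K = E.asField} {K′ = L} E⊂L E.ιℚ ιℚ

  -- Inherited from `τ`, which extends `conj` to `L`.
  conj-involutive : ∀ x → conj· (conj· x) E.≈ x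
  conj-involutive x = E⊂L-injective (begin
    ι.⟦ conj· (conj· x) ⟧ ≈⟨ τ-extends (conj· x) ⟨
    τ· ι.⟦ conj· x ⟧      ≈⟨ τ.⟦⟧-cong (τ-extends x) ⟨
    τ· (τ· ι.⟦ x ⟧)       ≈⟨ τ²≈1 _ ⟩
    ι.⟦ x ⟧               ∎)

  private
    module Q  = QuadraticExtension F E F⊂E quadratic conj conj≉1 conj-involutive
    module C₆ = CyclicOfOrder6 GalL/F cyclic
    module γ  = Automorphism C₆.γ

    γ : Carrier → Carrier
    γ = γ.ap

    δ : E.Carrier
    δ = proj₁ Q.antiFixed

    δ≉0 : δ E.≉ E.0#
    δ≉0 = proj₁ (proj₂ Q.antiFixed)

    -- The square of `d` comes from `F`, so an element of Gal(L/F) fixes or negates `d`; the sign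
    -- tells whether it acts trivially on `E`.
    d : Carrier
    d = ι.⟦ δ ⟧

    conj-δ : conj· δ E.≈ E.- δ
    conj-δ = proj₂ (proj₂ Q.antiFixed)

    d≉-d : d ≉ - d
    d≉-d d≈-d = δ≉0 (fieldHomo-≈0 {K = E.asField} {K′ = L} E⊂L E.ιℚ ιℚ
      (x+x≈0⇒x≈0 (trans (+-congˡ d≈-d) (-‿inverseʳ d))))

    τd≈-d : τ· d ≈ - d
    τd≈-d = trans (τ-extends δ) (trans (ι.⟦⟧-cong conj-δ) (ι.-‿homo δ))

    γ³≈τ : ∀ x → γ (γ (γ x)) ≈ τ· x
    γ³≈τ = C₆.involution≈γ³ τ τ≉1 τ²≈1

    γ-fixes-d² : γ (d * d) ≈ d * d
    γ-fixes-d² = let p , δ²≈p = Q.δ²∈F δ≉0 conj-δ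
                     d²≈p = trans (sym (ι.*-homo δ δ)) (ι.⟦⟧-cong δ²≈p)
                 in trans (γ.⟦⟧-cong d²≈p) (trans (γ.fixes p) (sym d²≈p))

    -- If `γ` fixed `d`, so would `γ³`, which is `τ` and negates `d`.
    γd≈-d : γ d ≈ - d
    γd≈-d = x²≈y²⇒x≈-y (trans (sym (γ.*-homo d d)) γ-fixes-d²) λ γd≈d →
      d≉-d (begin
        d            ≈⟨ γd≈d ⟨
        γ d          ≈⟨ γ.⟦⟧-cong γd≈d ⟨
        γ (γ d)      ≈⟨ γ.⟦⟧-cong (γ.⟦⟧-cong γd≈d) ⟨
        γ (γ (γ d))  ≈⟨ γ³≈τ d ⟩
        τ· d         ≈⟨ τd≈-d ⟩
        - d          ∎)

    γ²d≈d : γ (γ d) ≈ d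
    γ²d≈d = trans (γ.⟦⟧-cong γd≈-d) (trans (γ.-‿homo d) (trans (-‿cong γd≈-d) (-‿involutive d)))

    γ²-fixes-combination : ∀ {e} p q → e E.≈ F⊂E.⟦ p ⟧ E.+ F⊂E.⟦ q ⟧ E.* δ → γ (γ ι.⟦ e ⟧) ≈ ι.⟦ e ⟧
    γ²-fixes-combination {e} p q e≈p+qδ = begin
      γ (γ ι.⟦ e ⟧)          ≈⟨ γ.⟦⟧-cong (γ.⟦⟧-cong e≈) ⟩
      γ (γ (P + R * d))      ≈⟨ γ.⟦⟧-cong (γ-linear d) ⟩
      γ (P + R * γ d)        ≈⟨ γ-linear (γ d) ⟩
      P + R * γ (γ d)        ≈⟨ +-congˡ (*-congˡ γ²d≈d) ⟩
      P + R * d              ≈⟨ e≈ ⟨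
      ι.⟦ e ⟧                ∎
      where
      P R : Carrier
      P = ι.⟦ F⊂E.⟦ p ⟧ ⟧
      R = ι.⟦ F⊂E.⟦ q ⟧ ⟧
      γ-linear : ∀ x → γ (P + R * x) ≈ P + R * γ x
      γ-linear x = trans (γ.+-homo _ _) (+-cong (γ.fixes p) (trans (γ.*-homo R x) (*-congʳ (γ.fixes q))))
      e≈ : ι.⟦ e ⟧ ≈ P + R * d
      e≈ = trans (ι.⟦⟧-cong e≈p+qδ) (trans (ι.+-homo _ _) (+-congˡ (ι.*-homo _ _)))

    γ²-fixes-E : ∀ e → γ (γ ι.⟦ e ⟧) ≈ ι.⟦ e ⟧
    γ²-fixes-E e = let p , q , e≈p+qδ = Q.F+Fδ δ≉0 conj-δ e in γ²-fixes-combination p q e≈p+qδ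

    -- Seen over `E`, `γ²` is a power of the generator `ρ`, so it fixes whatever `ρ` fixes.
    γ²/E : GalL/E.Carrier
    γ²/E = record
      { ap                = λ x → γ (γ x)
      ; isRingIsomorphism = Automorphism.isRingIsomorphism (C₆.γ GalL/F.∙ C₆.γ)
      ; fixes             = γ²-fixes-E
      }

    -- Seen over `F`, `ρ` is a power of `γ`; its order is read off from the exponent.
    ρ/F : GalL/F.Carrier
    ρ/F = record
      { ap                = ρ·
      ; isRingIsomorphism = ρ.isRingIsomorphism
      ; fixes             = λ x → ρ.fixes F⊂E.⟦ x ⟧
      }

    open MonoidMult GalL/F.monoid using () renaming (_×_ to _timesF_)

    ρ-fixed⇒γ²-fixed : ∀ {x} → ρ· x ≈ x → γ (γ x) ≈ x
    ρ-fixed⇒γ²-fixed {x} ρx≈x = let k , ρᵏ≈γ² = ρ-gen γ²/E in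
      trans (sym (ρᵏ≈γ² x)) (powers-fix {K = E.asField} {L = L} E⊂L ρ ρx≈x k)

    γ-fixed⇒∈F : ∀ {x} → γ x ≈ x → ∃[ y ] ι.⟦ F⊂E.⟦ y ⟧ ⟧ ≈ x
    γ-fixed⇒∈F {x} γx≈x = IsFiniteGalois.fixedField galois x λ σ →
      let k , γᵏ≈σ = C₆.isPower σ in
      trans (sym (γᵏ≈σ x)) (powers-fix {K = F.asField} {L = L} F⊂L C₆.γ γx≈x (toℕ k))

    module _ {x : Carrier} (γ²x≈x : γ (γ x) ≈ x) where

      trace-fixed : γ (x + γ x) ≈ x + γ x
      trace-fixed = trans (γ.+-homo _ _) (trans (+-congˡ γ²x≈x) (+-comm _ _))

      -- Both `x - γ x` and `d` change sign under `γ`, so multiplication by `d` carries the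
      -- antisymmetric part of `x` into the fixed field of `γ`.
      twisted-trace-fixed : γ ((x - γ x) * d) ≈ (x - γ x) * d
      twisted-trace-fixed = begin
        γ ((x - γ x) * d)  ≈⟨ γ.*-homo _ d ⟩
        γ (x - γ x) * γ d  ≈⟨ *-cong (trans (γ.+-homo _ _) (+-congˡ (trans (γ.-‿homo _) (-‿cong γ²x≈x)))) γd≈-d ⟩
        (γ x - x) * - d    ≈⟨ solve 3 (λ x u d → (u :- x) :* (:- d) := (x :- u) :* d) refl x (γ x) d ⟩
        (x - γ x) * d      ∎

    -- Dividing the twisted trace by `d` recovers `x - γ x`; `x` is half the sum of this and the
    -- trace.
    traces∈E⇒∈E : ∀ {x p q} → ι.⟦ p ⟧ ≈ x + γ x → ι.⟦ q ⟧ ≈ (x - γ x) * d → ∃[ e ] ι.⟦ e ⟧ ≈ x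
    traces∈E⇒∈E {x} {p} {q} p≈ q≈ = EA.half E.* (p E.+ q E.* δ⁻¹) , (begin
      ι.⟦ EA.half E.* (p E.+ q E.* δ⁻¹) ⟧
        ≈⟨ trans (ι.*-homo _ _) (*-congˡ (trans (ι.+-homo _ _) (+-cong p≈ (trans (ι.*-homo _ _) (*-congʳ q≈))))) ⟩
      half * ((x + γ x) + (x - γ x) * d * ι.⟦ δ⁻¹ ⟧)
        ≈⟨ *-congˡ (+-congˡ (trans (*-assoc _ _ _) (trans (*-congˡ dδ⁻¹≈1) (*-identityʳ _)))) ⟩
      half * ((x + γ x) + (x - γ x))
        ≈⟨ *-congˡ (solve 2 (λ x u → (x :+ u) :+ (x :- u) := x :+ x) refl x (γ x)) ⟩
      half * (x + x)
        ≈⟨ half*[x+x]≈x x ⟩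
      x ∎)
      where
      module EA = ℚ-Algebra E.asField E.ιℚ
      δ⁻¹ : E.Carrier
      δ⁻¹ = E.inverse δ δ≉0
      dδ⁻¹≈1 : d * ι.⟦ δ⁻¹ ⟧ ≈ 1#
      dδ⁻¹≈1 = trans (sym (ι.*-homo _ _)) (trans (ι.⟦⟧-cong (EA.inverseʳ δ≉0)) ι.1#-homo)

  -- The hypothesis `galois` describes the fixed field over `F`, so the descent to `E` is explicit:
  -- `x` is fixed by `γ²`, hence its trace and twisted trace under `γ` lie in `F`, and together with
  -- `d` they determine `x`.
  ρ-fixed⇒∈E : ∀ {x} → ρ· x ≈ x → ∃[ e ] ι.⟦ e ⟧ ≈ x
  ρ-fixed⇒∈E {x} ρx≈x =
    let γ²x≈x  = ρ-fixed⇒γ²-fixed ρx≈x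
        p , p≈ = γ-fixed⇒∈F (trace-fixed γ²x≈x)
        q , q≈ = γ-fixed⇒∈F (twisted-trace-fixed γ²x≈x)
    in traces∈E⇒∈E p≈ q≈

  -- Write `ρ` as `γᵏ`. Odd powers of `γ` negate `d` while `ρ` fixes it, so `k` is 0, 2 or 4 and
  -- `3k` is a multiple of 6.
  ρ³≈id : ∀ x → ρ· (ρ· (ρ· x)) ≈ x
  ρ³≈id = let k , γᵏ≈ρ = C₆.isPower ρ/F in go k γᵏ≈ρ
    where
    cube : ∀ σ → (∀ x → Automorphism.ap σ x ≈ ρ· x) → ∀ x →
      ρ· (ρ· (ρ· x)) ≈ Automorphism.ap σ (Automorphism.ap σ (Automorphism.ap σ x))
    cube σ p x = trans (sym (p _)) (σ.⟦⟧-cong (trans (sym (p _)) (σ.⟦⟧-cong (sym (p x)))))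
      where module σ = Automorphism σ

    ρd≈d : ρ· d ≈ d
    ρd≈d = ρ.fixes δ

    γd≉d : ¬ γ d ≈ d
    γd≉d p = d≉-d (trans (sym p) γd≈-d)

    go : ∀ (k : Fin 6) → toℕ k timesF C₆.γ GalL/F.≈ ρ/F → ∀ x → ρ· (ρ· (ρ· x)) ≈ x
    go 0F p x = cube GalL/F.ε p x
    go 1F p x = ⊥-elim (γd≉d (trans (p d) ρd≈d))
    go 2F p x = trans (cube (2 timesF C₆.γ) p x) (C₆.γ⁶≈ε x)
    go 3F p x = ⊥-elim (γd≉d (trans (sym (γ.⟦⟧-cong γ²d≈d)) (trans (p d) ρd≈d)))
    go 4F p x = trans (cube (4 timesF C₆.γ) p x) (trans (C₆.γ⁶≈ε _) (C₆.γ⁶≈ε x))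
    go 5F p x = ⊥-elim (γd≉d (trans (sym (γ.⟦⟧-cong (trans (γ.⟦⟧-cong (γ.⟦⟧-cong γ²d≈d)) γ²d≈d)))
                                    (trans (p d) ρd≈d)))

-- Elements of `L` inside `D`: reduced norm, involution and eigenvectors.

module _ {c ℓ} (K : Field c ℓ) where
  open Field K

  det₃-lowerTriangular : (A : Fin 3 → Fin 3 → Carrier) → A 0F 1F ≈ 0# → A 0F 2F ≈ 0# → A 1F 2F ≈ 0# →
         det rawRing A ≈ A 0F 0F * (A 1F 1F * A 2F 2F)
  det₃-lowerTriangular A A₀₁≈0 A₀₂≈0 A₁₂≈0 =
    trans (+-cong (*-identityˡ _) (+-cong (vanish A₀₁≈0) (+-congʳ (vanish A₀₂≈0))))
      (trans (drop₂ _) (*-congˡ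
        (trans (+-cong (*-identityˡ _) (+-congʳ (vanish A₁₂≈0)))
          (trans (drop₁ _) (*-congˡ (trans (+-identityʳ _) (trans (*-identityˡ _) (*-identityʳ _))))))))
    where
    vanish : ∀ {s x y} → x ≈ 0# → s * (x * y) ≈ 0#
    vanish x≈0 = trans (*-congˡ (trans (*-congʳ x≈0) (zeroˡ _))) (zeroʳ _)
    drop₁ : ∀ x → x + (0# + 0#) ≈ x
    drop₁ x = trans (+-congˡ (+-identityˡ 0#)) (+-identityʳ x)
    drop₂ : ∀ x → x + (0# + (0# + 0#)) ≈ x
    drop₂ x = trans (+-congˡ (+-identityˡ _)) (drop₁ x)

module Eigenvectors {c ℓ} (S : Setting c ℓ) where
  open Setting S
  open Construction S
  open GaloisAction S
  open Field L
  open ℚ-Algebra L ιℚ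
  open RingProperties ring using (-‿involutive; -0#≈0#)
  open SetoidReasoning setoid
  open Solver using (solve; _:=_; _:+_; _:*_; :-_)
  private
    module τ = Automorphism τ
    module ρ = Automorphism ρ
    module ι = RingHomomorphism E⊂L
    module Cρ = Cubic ρ.isRingMonomorphism ρ³≈id

  -- Membership in the subfield `L` of `D`. Such elements need not be central: right multiplication
  -- by one multiplies the coefficient of `zʲ` by its image under `ρʲ`.
  record IsScalar (g : D.Carrier) : Set ℓ where
    field
      coeff₁≈0 : g 1F ≈ 0#
      coeff₂≈0 : g 2F ≈ 0#

  open IsScalar

  module _ (X : D.Carrier) {g : D.Carrier} (g∈L : IsScalar g) where
    private
      ρg₁≈0 : ρ· (g 1F) ≈ 0#
      ρg₁≈0 = trans (ρ.⟦⟧-cong (coeff₁≈0 g∈L)) ρ.0#-homo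
      ρg₂≈0 : ρ· (g 2F) ≈ 0#
      ρg₂≈0 = trans (ρ.⟦⟧-cong (coeff₂≈0 g∈L)) ρ.0#-homo
      ρρg₁≈0 : ρ· (ρ· (g 1F)) ≈ 0#
      ρρg₁≈0 = trans (ρ.⟦⟧-cong ρg₁≈0) ρ.0#-homo
      ρρg₂≈0 : ρ· (ρ· (g 2F)) ≈ 0#
      ρρg₂≈0 = trans (ρ.⟦⟧-cong ρg₂≈0) ρ.0#-homo
      *0 : ∀ {x y} → y ≈ 0# → x * y ≈ 0#
      *0 y≈0 = trans (*-congˡ y≈0) (zeroʳ _)
      0+0 : ∀ {x y} → x ≈ 0# → y ≈ 0# → x + y ≈ 0#
      0+0 p q = trans (+-cong p q) (+-identityˡ 0#)
      x+0 : ∀ {x y} → y ≈ 0# → x + y ≈ x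
      x+0 p = trans (+-congˡ p) (+-identityʳ _)

    *-scalar₀ : (X D.* g) 0F ≈ X 0F * g 0F
    *-scalar₀ = x+0 (*0 (0+0 (*0 ρg₂≈0) (*0 ρρg₁≈0)))

    *-scalar₁ : (X D.* g) 1F ≈ X 1F * ρ· (g 0F)
    *-scalar₁ = trans (x+0 (*0 (*0 ρρg₂≈0))) (trans (+-congʳ (*0 (coeff₁≈0 g∈L))) (+-identityˡ _))

    *-scalar₂ : (X D.* g) 2F ≈ X 2F * ρ· (ρ· (g 0F))
    *-scalar₂ = trans (+-congʳ (0+0 (*0 (coeff₂≈0 g∈L)) (*0 ρg₁≈0))) (+-identityˡ _)

    *-zero : g 0F ≈ 0# → ∀ i → (X D.* g) i ≈ 0#
    *-zero g₀≈0 0F = trans *-scalar₀ (*0 g₀≈0)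
    *-zero g₀≈0 1F = trans *-scalar₁ (*0 (trans (ρ.⟦⟧-cong g₀≈0) ρ.0#-homo))
    *-zero g₀≈0 2F = trans *-scalar₂ (*0 (trans (ρ.⟦⟧-cong (trans (ρ.⟦⟧-cong g₀≈0) ρ.0#-homo)) ρ.0#-homo))

  fromL-scalar : ∀ l → IsScalar (fromL l)
  fromL-scalar l = record { coeff₁≈0 = refl ; coeff₂≈0 = refl }

  z-*₁ : ∀ y → (z D.* y) 1F ≈ ρ· (y 0F)
  z-*₁ y = begin
    0# * y 1F + 1# * ρ· (y 0F) + ι.⟦ a ⟧ * (0# * ρ· (ρ· (y 2F)))
      ≈⟨ +-cong (+-cong (zeroˡ _) (*-identityˡ _)) (trans (*-congˡ (zeroˡ _)) (zeroʳ _)) ⟩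
    0# + ρ· (y 0F) + 0# ≈⟨ trans (+-identityʳ _) (+-identityˡ _) ⟩
    ρ· (y 0F)           ∎

  z-*₂ : ∀ y → (z D.* y) 2F ≈ ρ· (y 1F)
  z-*₂ y = begin
    0# * y 2F + 1# * ρ· (y 1F) + 0# * ρ· (ρ· (y 0F))
      ≈⟨ +-cong (+-cong (zeroˡ _) (*-identityˡ _)) (zeroˡ _) ⟩
    0# + ρ· (y 1F) + 0# ≈⟨ trans (+-identityʳ _) (+-identityˡ _) ⟩
    ρ· (y 1F)           ∎

  -- For `g = x` in `L`, `zⁱ x = ρⁱ(x) zⁱ`, so the matrix is diagonal. The Laplace expansion reduces
  -- to the diagonal product once the entries above the diagonal vanish.
  Nrd-scalar : ∀ {g} → IsScalar g → Nrd g ≈ g 0F * (ρ· (g 0F) * ρ· (ρ· (g 0F)))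
  Nrd-scalar {g} g∈L = trans
    (det₃-lowerTriangular L (λ i j → ((z ^ᴰ toℕ i) D.* g) j)
      (trans (*-scalar₁ (z ^ᴰ 0) g∈L) (zeroˡ _))
      (trans (*-scalar₂ (z ^ᴰ 0) g∈L) (zeroˡ _))
      (trans (*-scalar₂ (z ^ᴰ 1) g∈L) (trans (*-congʳ (trans (z-*₂ (z ^ᴰ 0)) ρ.0#-homo)) (zeroˡ _))))
    (*-cong (trans (*-scalar₀ (z ^ᴰ 0) g∈L) (*-identityˡ _))
      (*-cong (trans (*-scalar₁ (z ^ᴰ 1) g∈L) (trans (*-congʳ z¹₁≈1) (*-identityˡ _)))
              (trans (*-scalar₂ (z ^ᴰ 2) g∈L) (trans (*-congʳ z²₂≈1) (*-identityˡ _)))))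
    where
    z¹₁≈1 : (z ^ᴰ 1) 1F ≈ 1#
    z¹₁≈1 = trans (z-*₁ (z ^ᴰ 0)) ρ.1#-homo
    z²₂≈1 : (z ^ᴰ 2) 2F ≈ 1#
    z²₂≈1 = trans (z-*₂ (z ^ᴰ 1)) (trans (ρ.⟦⟧-cong z¹₁≈1) ρ.1#-homo)

  α-scalar : ∀ {g} → IsScalar g → α g D.≈ fromL (τ· (g 0F))
  α-scalar {g} g∈L i = begin
    (fromL (τ· (g 0F)) i + (αz D.* fromL (τ· (g 1F))) i) + ((αz ^ᴰ 2) D.* fromL (τ· (g 2F))) i
      ≈⟨ +-cong (+-congˡ (*-zero αz (fromL-scalar _) (trans (τ.⟦⟧-cong (coeff₁≈0 g∈L)) τ.0#-homo) i))
                (*-zero (αz ^ᴰ 2) (fromL-scalar _) (trans (τ.⟦⟧-cong (coeff₂≈0 g∈L)) τ.0#-homo) i) ⟩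
    (fromL (τ· (g 0F)) i + 0#) + 0# ≈⟨ trans (+-identityʳ _) (+-identityʳ _) ⟩
    fromL (τ· (g 0F)) i ∎

  -- `D` is given as a raw ring, so the ring laws used here are verified coefficient by coefficient.
  D-*-congʳ : ∀ {x y} g → x D.≈ y → (x D.* g) D.≈ (y D.* g)
  D-*-congʳ g x≈y 0F = +-cong (*-congʳ (x≈y 0F)) (*-congˡ (+-cong (*-congʳ (x≈y 1F)) (*-congʳ (x≈y 2F))))
  D-*-congʳ g x≈y 1F = +-cong (+-cong (*-congʳ (x≈y 0F)) (*-congʳ (x≈y 1F))) (*-congˡ (*-congʳ (x≈y 2F)))
  D-*-congʳ g x≈y 2F = +-cong (+-cong (*-congʳ (x≈y 0F)) (*-congʳ (x≈y 1F))) (*-congʳ (x≈y 2F))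

  D-neg-* : ∀ x g → ((D.- x) D.* g) D.≈ (D.- (x D.* g))
  D-neg-* x g 0F = solve 7 (λ x₀ x₁ x₂ a p q r →
    (:- x₀) :* p :+ a :* ((:- x₁) :* q :+ (:- x₂) :* r) := :- (x₀ :* p :+ a :* (x₁ :* q :+ x₂ :* r)))
    refl (x 0F) (x 1F) (x 2F) ι.⟦ a ⟧ (g 0F) (ρ· (g 2F)) (ρ· (ρ· (g 1F)))
  D-neg-* x g 1F = solve 7 (λ x₀ x₁ x₂ a p q r →
    (:- x₀) :* p :+ (:- x₁) :* q :+ a :* ((:- x₂) :* r) := :- (x₀ :* p :+ x₁ :* q :+ a :* (x₂ :* r)))
    refl (x 0F) (x 1F) (x 2F) ι.⟦ a ⟧ (g 1F) (ρ· (g 0F)) (ρ· (ρ· (g 2F)))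
  D-neg-* x g 2F = solve 6 (λ x₀ x₁ x₂ p q r →
    (:- x₀) :* p :+ (:- x₁) :* q :+ (:- x₂) :* r := :- (x₀ :* p :+ x₁ :* q :+ x₂ :* r))
    refl (x 0F) (x 1F) (x 2F) (g 2F) (ρ· (g 1F)) (ρ· (ρ· (g 0F)))

  IsEigenvector : D.Carrier → Set ℓ
  IsEigenvector g = α g D.≈ g ⊎ α g D.≈ (D.- g)

  g²≈±1 : ∀ {g} → 𝕌 g → IsEigenvector g → (g D.* g) D.≈ D.1# ⊎ (g D.* g) D.≈ (D.- D.1#)
  g²≈±1 {g} (_ , αg*g≈1) (inj₁ αg≈g) = inj₁ λ i →
    trans (sym (D-*-congʳ g αg≈g i)) (αg*g≈1 i)
  g²≈±1 {g} (_ , αg*g≈1) (inj₂ αg≈-g) = inj₂ λ i → begin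
    (g D.* g) i         ≈⟨ -‿involutive _ ⟨
    - - (g D.* g) i     ≈⟨ -‿cong (D-neg-* g g i) ⟨
    - ((D.- g) D.* g) i ≈⟨ -‿cong (D-*-congʳ g αg≈-g i) ⟨
    - (α g D.* g) i     ≈⟨ -‿cong (αg*g≈1 i) ⟩
    - D.1# i            ∎

  -- The coefficients of `z` and `z²` in `g D.* g` are, by definition of the product, the
  -- expressions that `Cubic` assumes to vanish. There a nonzero `w` would make `a` a norm, which
  -- `a∉N` excludes; `stable` turns this into `w = 0`.
  g²∈L⇒g∈L : ∀ {g} → IsScalar (g D.* g) → IsScalar g
  g²∈L⇒g∈L {g} g²∈L = record
    { coeff₁≈0 = Cρ.w≈0⇒y≈0 (ρ.fixes a) ⟦a⟧≉0 (coeff₁≈0 g²∈L) (coeff₂≈0 g²∈L) w≈0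
    ; coeff₂≈0 = w≈0
    }
    where
    ⟦a⟧≉0 : ι.⟦ a ⟧ ≉ 0#
    ⟦a⟧≉0 p = a≉0 (E⊂L-injective (trans p (sym ι.0#-homo)))
    w≈0 : g 2F ≈ 0#
    w≈0 = stable λ w≉0 →
      a∉N (Cρ.w≉0⇒a∈N (ρ.fixes a) ⟦a⟧≉0 (coeff₁≈0 g²∈L) (coeff₂≈0 g²∈L) w≉0)

  ±1-scalar : ∀ {h} → h D.≈ D.1# ⊎ h D.≈ (D.- D.1#) → IsScalar h
  ±1-scalar (inj₁ p) = record { coeff₁≈0 = p 1F ; coeff₂≈0 = p 2F }
  ±1-scalar (inj₂ p) = record { coeff₁≈0 = trans (p 1F) -0#≈0# ; coeff₂≈0 = trans (p 2F) -0#≈0# }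

  x²≈±1⇒x⁴≈1 : ∀ {x} → (x * x ≈ 1# ⊎ x * x ≈ - 1#) → (x * x) * (x * x) ≈ 1#
  x²≈±1⇒x⁴≈1 (inj₁ p) = trans (*-cong p p) (*-identityˡ 1#)
  x²≈±1⇒x⁴≈1 (inj₂ p) = trans (*-cong p p) -1*-1≈1

  ⟦e⁴⟧ : ∀ e → ι.⟦ e E.^ 4 ⟧ ≈ (ι.⟦ e ⟧ * ι.⟦ e ⟧) * (ι.⟦ e ⟧ * ι.⟦ e ⟧)
  ⟦e⁴⟧ e = begin
    ι.⟦ e E.^ 4 ⟧ ≈⟨ ι.⟦⟧-cong (E.trans (E.*-congˡ (E.*-congˡ (E.*-congˡ (E.*-identityʳ e)))) (E.sym (E.*-assoc _ _ _))) ⟩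
    ι.⟦ (e E.* e) E.* (e E.* e) ⟧ ≈⟨ trans (ι.*-homo _ _) (*-cong (ι.*-homo e e) (ι.*-homo e e)) ⟩
    (ι.⟦ e ⟧ * ι.⟦ e ⟧) * (ι.⟦ e ⟧ * ι.⟦ e ⟧) ∎

  eigenvector⇒root : ∀ {g} → 𝕌 g → IsEigenvector g → IsFourthRootOfUnityInE g
  eigenvector⇒root {g} g∈𝕌 eig = e , e⁴≈1 , g≈e
    where
    g²≈ : (g D.* g) D.≈ D.1# ⊎ (g D.* g) D.≈ (D.- D.1#)
    g²≈ = g²≈±1 g∈𝕌 eig
    g∈L : IsScalar g
    g∈L = g²∈L⇒g∈L (±1-scalar g²≈)
    x²≈ : g 0F * g 0F ≈ 1# ⊎ g 0F * g 0F ≈ - 1#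
    x²≈ = Sum.map coeff₀ coeff₀ g²≈
      where
      coeff₀ : ∀ {h} → (g D.* g) D.≈ h → g 0F * g 0F ≈ h 0F
      coeff₀ p = trans (sym (*-scalar₀ g g∈L)) (p 0F)
    x∈E : ∃[ e ] ι.⟦ e ⟧ ≈ g 0F
    x∈E = ρ-fixed⇒∈E (Cρ.x²≈±1⇒σx≈x x²≈)
    e : E.Carrier
    e = proj₁ x∈E
    e≈x : ι.⟦ e ⟧ ≈ g 0F
    e≈x = proj₂ x∈E
    e⁴≈1 : e E.^ 4 E.≈ E.1#
    e⁴≈1 = E⊂L-injective (begin
      ι.⟦ e E.^ 4 ⟧                  ≈⟨ ⟦e⁴⟧ e ⟩
      (ι.⟦ e ⟧ * ι.⟦ e ⟧) * (ι.⟦ e ⟧ * ι.⟦ e ⟧) ≈⟨ *-cong (*-cong e≈x e≈x) (*-cong e≈x e≈x) ⟩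
      (g 0F * g 0F) * (g 0F * g 0F)  ≈⟨ x²≈±1⇒x⁴≈1 x²≈ ⟩
      1#                             ≈⟨ ι.1#-homo ⟨
      ι.⟦ E.1# ⟧                     ∎)
    g≈e : g D.≈ fromE e
    g≈e 0F = sym e≈x
    g≈e 1F = coeff₁≈0 g∈L
    g≈e 2F = coeff₂≈0 g∈L

  root⇒scalar : ∀ {g} → IsFourthRootOfUnityInE g → IsScalar g
  root⇒scalar (_ , _ , g≈e) = record { coeff₁≈0 = g≈e 1F ; coeff₂≈0 = g≈e 2F }

  root⇒x⁴≈1 : ∀ {g} → IsFourthRootOfUnityInE g → (g 0F * g 0F) * (g 0F * g 0F) ≈ 1#
  root⇒x⁴≈1 (e , e⁴≈1 , g≈e) = trans (*-cong (*-cong (g≈e 0F) (g≈e 0F)) (*-cong (g≈e 0F) (g≈e 0F)))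
    (trans (sym (⟦e⁴⟧ e)) (trans (ι.⟦⟧-cong e⁴≈1) ι.1#-homo))

  -- Here `g = x` lies in `L` and `x² = ±1`. Multiplying `τ(x) x = 1` by `x` gives `τ(x) x² = x`,
  -- that is `τ(x) = ±x` with the same sign, and `α` acts on `L` as `τ`.
  root⇒eigenvector : ∀ {g} → 𝕌 g → IsFourthRootOfUnityInE g → IsEigenvector g
  root⇒eigenvector {g} (_ , αg*g≈1) root = Sum.map αg≈g αg≈-g (x²≈1⇒x≈±1 (root⇒x⁴≈1 root))
    where
    x : Carrier
    x = g 0F
    g∈L : IsScalar g
    g∈L = root⇒scalar root
    τx*x≈1 : τ· x * x ≈ 1#
    τx*x≈1 = trans (*-congʳ (sym (α-scalar g∈L 0F))) (trans (sym (*-scalar₀ (α g) g∈L)) (αg*g≈1 0F))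
    τx*x²≈x : τ· x * (x * x) ≈ x
    τx*x²≈x = trans (sym (*-assoc _ _ _)) (trans (*-congʳ τx*x≈1) (*-identityˡ x))
    αg≈g : x * x ≈ 1# → α g D.≈ g
    αg≈g p i = trans (α-scalar g∈L i) (lemma i)
      where
      lemma : fromL (τ· x) D.≈ g
      lemma 0F = trans (sym (*-identityʳ _)) (trans (*-congˡ (sym p)) τx*x²≈x)
      lemma 1F = sym (coeff₁≈0 g∈L)
      lemma 2F = sym (coeff₂≈0 g∈L)
    αg≈-g : x * x ≈ - 1# → α g D.≈ (D.- g)
    αg≈-g p i = trans (α-scalar g∈L i) (lemma i)
      where
      lemma : fromL (τ· x) D.≈ (D.- g)
      lemma 0F = begin
        τ· x               ≈⟨ *-identityʳ _ ⟨
        τ· x * 1#          ≈⟨ solve 2 (λ t u → t :* u := :- (t :* (:- u))) refl (τ· x) 1# ⟩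
        - (τ· x * - 1#)    ≈⟨ -‿cong (trans (*-congˡ (sym p)) τx*x²≈x) ⟩
        - x                ∎
      lemma 1F = trans (sym -0#≈0#) (-‿cong (sym (coeff₁≈0 g∈L)))
      lemma 2F = trans (sym -0#≈0#) (-‿cong (sym (coeff₂≈0 g∈L)))

  -- Both signs are treated at once; the two negative claims for `g` other than 1 follow by
  -- contraposition.
  𝔾-eigenvector⇒1 : ∀ {g} → 𝔾 g → IsEigenvector g → g D.≈ D.1#
  𝔾-eigenvector⇒1 {g} (g∈𝕌 , Nrd≈1) eig = g≈1
    where
    root : IsFourthRootOfUnityInE g
    root = eigenvector⇒root g∈𝕌 eig
    x : Carrier
    x = g 0F
    ρx≈x : ρ· x ≈ x
    ρx≈x = let e , _ , g≈e = root in trans (ρ.⟦⟧-cong (g≈e 0F)) (trans (ρ.fixes e) (sym (g≈e 0F)))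
    x³≈1 : x * (x * x) ≈ 1#
    x³≈1 = trans (sym (trans (Nrd-scalar (root⇒scalar root))
      (*-congˡ (*-cong ρx≈x (trans (ρ.⟦⟧-cong ρx≈x) ρx≈x))))) Nrd≈1
    g≈1 : g D.≈ D.1#
    g≈1 0F = begin
      x                  ≈⟨ *-identityʳ x ⟨
      x * 1#             ≈⟨ *-congˡ x³≈1 ⟨
      x * (x * (x * x))  ≈⟨ *-assoc x x _ ⟨
      (x * x) * (x * x)  ≈⟨ root⇒x⁴≈1 root ⟩
      1#                 ∎
    g≈1 1F = coeff₁≈0 (root⇒scalar root)
    g≈1 2F = coeff₂≈0 (root⇒scalar root)

theorem3p3 : ∀ {c ℓ} (S : Setting c ℓ) → let open Construction S in
    (∀ g → 𝔾 g → ¬ (g D.≈ D.1#) → ¬ (α g D.≈ g) × ¬ (α g D.≈ (D.- g))) ×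
    (∀ g → 𝕌 g → (α g D.≈ g ⊎ α g D.≈ (D.- g)) ⇔ IsFourthRootOfUnityInE g)
theorem3p3 S =
  (λ g g∈𝔾 g≉1 → (λ αg≈g → g≉1 (𝔾-eigenvector⇒1 g∈𝔾 (inj₁ αg≈g))) ,
                  (λ αg≈-g → g≉1 (𝔾-eigenvector⇒1 g∈𝔾 (inj₂ αg≈-g)))) ,
  (λ g g∈𝕌 → mk⇔ (eigenvector⇒root g∈𝕌) (root⇒eigenvector g∈𝕌))
  where open Eigenvectors S
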